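{- There is a constant $c>0$ such that for every sufficiently large $n$ for which $\sqrt{n}$ is an odd integer, every deterministic $\mathsf{Online}$-$\mathsf{LOCAL}$ algorithm that properly 3-colors every $(\sqrt{n}\times\sqrt{n})$ toroidal grid has locality at least $c\sqrt{n}$, and the same holds for $(\sqrt{n}\times\sqrt{n})$ cylindrical grids. That is, the locality of 3-coloring $(\sqrt{n}\times\sqrt{n})$ toroidal and cylindrical grids in $\mathsf{Online}$-$\mathsf{LOCAL}$ is $\Omega(\sqrt{n})$.
   Context: For a graph $G=(V,E)$, $U\subseteq V$ and an integer $T\ge 0$, $\mathcal{B}(U,T)$ denotes the set of nodes at distance at most $T$ from some node of $U$, and $G[U]$ denotes the induced subgraph. The $\mathsf{Online}$-$\mathsf{LOCAL}$ model: an algorithm with locality $T=T(n)$ is deterministic and knows $n$. The adversary chooses an $n$-node input graph $G=(V,E)$ from the input family, assigns distinct identifiers from $\{1,\dots,\mathrm{poly}(n)\}$ to its nodes, and chooses an ordering $\sigma=(v_1,\dots,v_n)$ of $V$. For $i=1,\dots,n$, when $v_i$ is presented, the algorithm must irrevocably assign an output (here a color) to $v_i$ as a function of the sequence $(v_1,\dots,v_i)$ and the induced subgraph $G_i=G\big[\bigcup_{j\le i}\mathcal{B}(v_j,T)\big]$ (with identifiers); thus the algorithm has global memory of everything seen so far. The algorithm solves a coloring problem on an input family if for every choice of the adversary the final coloring is proper and uses only the allowed colors. The locality of a problem is the minimum locality of an algorithm solving it. An $(a\times b)$ simple grid has node set $\{(i,j): i\in[a], j\in[b]\}$, with $(i,j)$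 and $(i',j')$ adjacent iff $|i-i'|+|j-j'|=1$. An $(a\times b)$ cylindrical grid is obtained from it by adding the edges $\{(i,1),(i,b)\}$ for all $i\in[a]$. An $(a\times b)$ toroidal grid is obtained from the cylindrical grid by further adding the edges $\{(1,j),(a,j)\}$ for all $j\in[b]$. -}

module Defs where

open import Data.Fin.Base as Fin using (Fin; toℕ)
import Data.Fin.Properties as Fin
open import Data.Fin.Subset using (Subset)
open import Data.List.Base as List using (List)
open import Data.Nat.Base
open import Data.Nat.Properties
  using (anyUpTo?; ∣-∣-comm; ∣n-n∣≡0) renaming (_≟_ to _≟ℕ_)
open import Data.Product.Base using (∃; ∃-syntax; _×_; _,_)
open import Data.Sum.Base as Sum using (_⊎_)
open import Data.Vec.Base as Vec using (Vec)
open import Function.Base using (_∘_)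
open import Function.Bundles using (_↔_; _↣_; Inverse; Injection)
open import Function.Properties.Inverse using (↔-sym; Inverse⇒Injection)
open import Level using (Level; 0ℓ) renaming (suc to lsuc)
open import Relation.Binary.Core using (Rel)
open import Relation.Binary.Definitions
  using (Symmetric; Irreflexive; DecidableEquality)
  renaming (Decidable to Decidable₂)
open import Relation.Binary.PropositionalEquality
  using (_≡_; _≢_; refl; sym; trans; cong₂; subst)
open import Relation.Nullary.Decidable
  using (Dec; does; map′; via-injection; ¬?; _×-dec_; _⊎-dec_)
open import Relation.Unary using (Pred; Decidable; ｛_｝)

------------------------------------------------------------------------
-- Finite simple graphs

record Graph : Set₁ where
  field
    Node       : Set
    size       : ℕ
    enum       : Fin size ↔ Node
    Adj        : Rel Node 0ℓ
    adj?       : Decidable₂ Adj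
    adj-sym    : Symmetric Adj
    adj-irrefl : Irreflexive _≡_ Adj

  infix 4 _≟_

  _≟_ : DecidableEquality Node
  _≟_ = via-injection (Inverse⇒Injection (↔-sym enum)) Fin._≟_

  anyNode? : {ℓ : Level} {P : Pred Node ℓ} → Decidable P → Dec (∃ P)
  anyNode? {P = P} P? = map′
    (λ (i , p) → Inverse.to enum i , p)
    (λ (v , p) → Inverse.from enum v
               , subst P (sym (Inverse.strictlyInverseˡ enum v)) p)
    (Fin.any? (P? ∘ Inverse.to enum))

  data Walk : ℕ → Node → Node → Set where
    []  : ∀ {v} → Walk 0 v v
    _∷_ : ∀ {k u v w} → Adj u v → Walk k v w → Walk (suc k) u w

  walk? : ∀ k → Decidable₂ (Walk k)
  walk? zero u v = map′ (λ { refl → [] }) (λ { [] → refl }) (u ≟ v)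
  walk? (suc k) u w = map′
    (λ (_ , e , p) → e ∷ p)
    (λ { (e ∷ p) → _ , e , p })
    (anyNode? λ v → adj? u v ×-dec walk? k v w)

  DistanceAtMost : ℕ → Rel Node 0ℓ
  DistanceAtMost T u v = ∃[ k ] (k ≤ T × Walk k u v)

  distanceAtMost? : ∀ T → Decidable₂ (DistanceAtMost T)
  distanceAtMost? T u v = map′
    (λ (k , k<1+T , p) → k , s≤s⁻¹ k<1+T , p)
    (λ (k , k≤T , p) → k , s≤s k≤T , p)
    (anyUpTo? (λ k → walk? k u v) (suc T))

  𝓑 : Pred Node 0ℓ → ℕ → Pred Node 0ℓ
  𝓑 U T v = ∃[ u ] (U u × DistanceAtMost T u v)

  𝓑? : {U : Pred Node 0ℓ} → Decidable U → ∀ T → Decidable (𝓑 U T)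
  𝓑? U? T v = anyNode? λ u → U? u ×-dec distanceAtMost? T u v

Proper : ∀ {k} (G : Graph) → (Graph.Node G → Fin k) → Set
Proper G colour = ∀ {u v} → Graph.Adj G u v → colour u ≢ colour v

------------------------------------------------------------------------
-- The Online-LOCAL model

-- What an algorithm has seen so far.  Identifiers 1, …, N are represented by
-- Fin N, and everything is stored as first-order data (a list, a bit vector
-- and an adjacency matrix, all over identifiers), so that algorithms cannot
-- tell apart extensionally equal views.
record View (N : ℕ) : Set where
  field
    presented : List (Fin N)
    seen      : Subset N
    edges     : Vec (Subset N) N

-- Algorithms with k allowed colours, for identifiers from {1, …, idBound n}
-- on n-node graphs.
record Algorithm (idBound : ℕ → ℕ) (k : ℕ) : Set where
  field
    locality : ℕ → ℕ
    output   : ∀ n → View (idBound n) → Fin k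

record Adversary (N : ℕ) (G : Graph) : Set where
  open Graph G
  field
    identifiers : Node ↣ Fin N
    ordering    : Fin size ↔ Node

  identifier : Node → Fin N
  identifier = Injection.to identifiers

  σ : Fin size → Node
  σ = Inverse.to ordering

  time : Node → Fin size
  time = Inverse.from ordering

  module _ (T : ℕ) (i : Fin size) where

    -- The node set of Gᵢ.
    Region : Pred Node 0ℓ
    Region v = ∃[ j ] (j Fin.≤ i × 𝓑 ｛ σ j ｝ T v)

    region? : Decidable Region
    region? v = Fin.any? λ j → (j Fin.≤? i) ×-dec 𝓑? (σ j ≟_) T v

    SeenId : Pred (Fin N) 0ℓ
    SeenId x = ∃[ v ] (identifier v ≡ x × Region v)

    seenId? : Decidable SeenId
    seenId? x = anyNode? λ v → (identifier v Fin.≟ x) ×-dec region? v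

    SeenEdge : Rel (Fin N) 0ℓ
    SeenEdge x y = ∃[ u ] ((identifier u ≡ x × Region u) ×
                   ∃[ v ] ((identifier v ≡ y × Region v) × Adj u v))

    seenEdge? : Decidable₂ SeenEdge
    seenEdge? x y =
      anyNode? λ u → ((identifier u Fin.≟ x) ×-dec region? u) ×-dec
      anyNode? λ v → ((identifier v Fin.≟ y) ×-dec region? v) ×-dec adj? u v

    view : View N
    view = record
      { presented = List.take (suc (toℕ i)) (List.tabulate (identifier ∘ σ))
      ; seen      = Vec.tabulate (does ∘ seenId?)
      ; edges     = Vec.tabulate λ x → Vec.tabulate λ y → does (seenEdge? x y)
      }

module _ {idBound : ℕ → ℕ} {k : ℕ} (A : Algorithm idBound k) where
  open Algorithm A

  colouring : (G : Graph) → Adversary (idBound (Graph.size G)) G →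
              Graph.Node G → Fin k
  colouring G adv v = output n (Adversary.view adv (locality n) (time v))
    where
    n = Graph.size G
    open Adversary adv using (time)

  Solves : Pred Graph (lsuc 0ℓ) → Set₁
  Solves Family = ∀ {G} → Family G →
    (adv : Adversary (idBound (Graph.size G)) G) → Proper G (colouring G adv)

PolynomiallyBounded : (ℕ → ℕ) → Set
PolynomiallyBounded p = ∃[ C ] ∃[ d ] (∀ n → p n ≤ C * n ^ d + C)

------------------------------------------------------------------------
-- Grids, with coordinates counted from 0

SimpleGridEdge : ∀ a b → Rel (Fin a × Fin b) 0ℓ
SimpleGridEdge a b (i , j) (i′ , j′) =
  ∣ toℕ i - toℕ i′ ∣ + ∣ toℕ j - toℕ j′ ∣ ≡ 1

simpleGrid : ℕ → ℕ → Graph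
simpleGrid a b = record
  { Node       = Fin a × Fin b
  ; size       = a * b
  ; enum       = Fin.*↔×
  ; Adj        = SimpleGridEdge a b
  ; adj?       = λ (i , j) (i′ , j′) →
                   (∣ toℕ i - toℕ i′ ∣ + ∣ toℕ j - toℕ j′ ∣) ≟ℕ 1
  ; adj-sym    = λ { {i , j} {i′ , j′} e → trans
                   (cong₂ _+_ (∣-∣-comm (toℕ i′) (toℕ i))
                              (∣-∣-comm (toℕ j′) (toℕ j))) e }
  ; adj-irrefl = λ { {i , j} refl e → 0≢1 (trans (sym
                   (cong₂ _+_ (∣n-n∣≡0 (toℕ i)) (∣n-n∣≡0 (toℕ j)))) e) }
  }
  where
  0≢1 : 0 ≢ 1
  0≢1 ()

addEdges : (G : Graph) (E : Rel (Graph.Node G) 0ℓ) →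
           Decidable₂ E → Symmetric E → Irreflexive _≡_ E → Graph
addEdges G E E? E-sym E-irrefl = record
  { Node       = Node
  ; size       = size
  ; enum       = enum
  ; Adj        = λ u v → Adj u v ⊎ E u v
  ; adj?       = λ u v → adj? u v ⊎-dec E? u v
  ; adj-sym    = Sum.map adj-sym E-sym
  ; adj-irrefl = λ u≡v → Sum.[ adj-irrefl u≡v , E-irrefl u≡v ]
  }
  where open Graph G

FirstLast : ∀ {m} → Rel (Fin m) 0ℓ
FirstLast {m} x y = toℕ x ≡ 0 × suc (toℕ y) ≡ m

-- {x , y} = {first , last}; the condition x ≢ y only matters for m = 1, where
-- it excludes a loop.
Wrap : ∀ {m} → Rel (Fin m) 0ℓ
Wrap x y = (FirstLast x y ⊎ FirstLast y x) × x ≢ y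

wrap? : ∀ {m} → Decidable₂ (Wrap {m})
wrap? {m} x y = (firstLast? x y ⊎-dec firstLast? y x) ×-dec ¬? (x Fin.≟ y)
  where
  firstLast? : Decidable₂ (FirstLast {m})
  firstLast? x y = (toℕ x ≟ℕ 0) ×-dec (suc (toℕ y) ≟ℕ m)

wrap-sym : ∀ {m} → Symmetric (Wrap {m})
wrap-sym (e , x≢y) = Sum.swap e , x≢y ∘ sym

RowWrap ColumnWrap : ∀ a b → Rel (Fin a × Fin b) 0ℓ
RowWrap    a b (i , j) (i′ , j′) = i ≡ i′ × Wrap j j′
ColumnWrap a b (i , j) (i′ , j′) = j ≡ j′ × Wrap i i′

cylindricalGrid : ℕ → ℕ → Graph
cylindricalGrid a b = addEdges (simpleGrid a b) (RowWrap a b)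
  (λ (i , j) (i′ , j′) → (i Fin.≟ i′) ×-dec wrap? j j′)
  (λ (p , w) → sym p , wrap-sym w)
  (λ { refl (_ , _ , j≢j) → j≢j refl })

toroidalGrid : ℕ → ℕ → Graph
toroidalGrid a b = addEdges (cylindricalGrid a b) (ColumnWrap a b)
  (λ (i , j) (i′ , j′) → (j Fin.≟ j′) ×-dec wrap? i i′)
  (λ (p , w) → sym p , wrap-sym w)
  (λ { refl (_ , _ , i≢i) → i≢i refl })

{-# OPTIONS --safe #-}

-- Orient every edge of a properly 3-coloured graph by whether the colour goes
-- up or down modulo 3 and count +1 or −1.  The sum around a 4-cycle is zero,
-- so all row cycles of the grid have the same winding number; it changes sign
-- when the row is read backwards, and it is odd when the row length is.
-- Present two distant rows first.  Until both are complete, the algorithm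
-- cannot distinguish the grid from the one in which all rows from some row
-- between them on are reflected, so the winding number w of both rows satisfies
-- w = −w, a contradiction.
module Submission where

open import Defs
open import Data.Empty using (⊥; ⊥-elim)
open import Data.Fin.Base as Fin using (Fin; zero; suc; toℕ; opposite)
import Data.Fin.Properties as Fin
import Data.Fin.Permutation as Perm
open import Data.Fin.Permutation.Components using (transpose)
open import Data.Integer.Base as ℤ using (ℤ; +_; 0ℤ; 1ℤ; -1ℤ)
import Data.Integer.Properties as ℤ
open import Data.Integer.Tactic.RingSolver using (solve-∀)
import Data.List.Base as List
import Data.List.Properties as List
open import Data.Nat.Base
  using (ℕ; zero; suc; _+_; _*_; _∸_; _≤_; _<_; ∣_-_∣; z≤n; s≤s; s≤s⁻¹)
open import Data.Nat.Divisibility using (_∣_; _∤_; divides)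
open import Data.Nat.DivMod using (_mod_; m<n⇒m%n≡m; m%n<n)
open import Data.Nat.Properties
import Data.Nat.Tactic.RingSolver as ℕ-Solver
open import Data.Product.Base
  using (∃-syntax; _×_; _,_; proj₁)
open import Data.Product.Function.NonDependent.Propositional using (_×-↔_)
open import Data.Rational.Base as ℚ using (0ℚ; _/_; toℚᵘ)
import Data.Rational.Properties as ℚ
import Data.Rational.Unnormalised.Base as ℚᵘ
import Data.Rational.Unnormalised.Properties as ℚᵘ
open import Data.Sum.Base as Sum using (_⊎_; inj₁; inj₂)
import Data.Vec.Properties as Vec
open import Function.Base using (_∘_)
open import Function.Bundles using (_↔_; mk↔ₛ′; mk↣; mk⇔)
open import Function.Construct.Composition using (_↔-∘_; _↣-∘_)
open import Function.Construct.Identity using (↔-id)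
open import Function.Properties.Inverse using (↔-sym; Inverse⇒Injection)
open import Level using (0ℓ)
open import Relation.Binary.Core using (Rel)
open import Relation.Binary.Definitions
  using (Symmetric; Irreflexive) renaming (Decidable to Decidable₂)
open import Relation.Binary.PropositionalEquality
  using (_≡_; _≢_; refl; sym; trans; cong; cong₂; subst; subst₂;
         module ≡-Reasoning)
open import Relation.Nullary.Decidable
  using (Dec; yes; no; ¬?; _→-dec_; toWitness; does-⇔; dec-true; dec-false)
open import Relation.Nullary.Negation using (¬_; contradiction)
open import Relation.Unary using (Pred; ｛_｝)

-- Winding numbers

δ : Fin 3 → Fin 3 → ℤ
δ zero             zero             = 0ℤ
δ zero             (suc zero)       = 1ℤ
δ zero             (suc (suc zero)) = -1ℤ
δ (suc zero)       zero             = -1ℤ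
δ (suc zero)       (suc zero)       = 0ℤ
δ (suc zero)       (suc (suc zero)) = 1ℤ
δ (suc (suc zero)) zero             = 1ℤ
δ (suc (suc zero)) (suc zero)       = -1ℤ
δ (suc (suc zero)) (suc (suc zero)) = 0ℤ

δ-antisym : ∀ a b → δ a b ℤ.+ δ b a ≡ 0ℤ
δ-antisym = toWitness {a? = Fin.all? λ a → Fin.all? λ b →
  (δ a b ℤ.+ δ b a) ℤ.≟ 0ℤ} _

δ-square : ∀ a b c d → a ≢ b → b ≢ d → a ≢ c → c ≢ d →
           δ a b ℤ.+ δ b d ≡ δ a c ℤ.+ δ c d
δ-square = toWitness
  {a? = Fin.all? λ a → Fin.all? λ b → Fin.all? λ c → Fin.all? λ d →
    ¬? (a Fin.≟ b) →-dec ¬? (b Fin.≟ d) →-dec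
    ¬? (a Fin.≟ c) →-dec ¬? (c Fin.≟ d) →-dec
    ((δ a b ℤ.+ δ b d) ℤ.≟ (δ a c ℤ.+ δ c d))} _

-- Parity is recorded by a natural witness: `e` is 1 on a descending edge and 0 on an ascending one.
-- Summed along a path or cycle it counts the descents.
δ-odd : ∀ a b → a ≢ b → ∃[ e ] (δ a b ℤ.+ + (e + e) ≡ 1ℤ)
δ-odd a b a≢b with toWitness {a? = Fin.all? λ a → Fin.all? λ b →
  ¬? (a Fin.≟ b) →-dec Fin.any? λ (e : Fin 2) →
  (δ a b ℤ.+ + (toℕ e + toℕ e)) ℤ.≟ 1ℤ} _ a b a≢b
... | e , eq = toℕ e , eq

climb : (ℕ → Fin 3) → ℕ → ℤ
climb f zero    = 0ℤ
climb f (suc k) = climb f k ℤ.+ δ (f k) (f (suc k))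

-- f describes a cycle of length m + 1; its values beyond m are irrelevant.
winding : ℕ → (ℕ → Fin 3) → ℤ
winding m f = climb f m ℤ.+ δ (f m) (f 0)

ProperCycle : ℕ → (ℕ → Fin 3) → Set
ProperCycle m f = (∀ {j} → j < m → f j ≢ f (suc j)) × f m ≢ f 0

climb-cong : ∀ {f g} k → (∀ {j} → j ≤ k → f j ≡ g j) → climb f k ≡ climb g k
climb-cong zero    f≗g = refl
climb-cong (suc k) f≗g = cong₂ ℤ._+_
  (climb-cong k (f≗g ∘ m≤n⇒m≤1+n))
  (cong₂ δ (f≗g (n≤1+n k)) (f≗g ≤-refl))

winding-cong : ∀ m {f g} → (∀ {j} → j ≤ m → f j ≡ g j) →
               winding m f ≡ winding m g
winding-cong m f≗g =
  cong₂ ℤ._+_ (climb-cong m f≗g) (cong₂ δ (f≗g ≤-refl) (f≗g z≤n))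

private
  add-odd : ∀ x y {m n} → ∃[ e ] (x ℤ.+ + (e + e) ≡ m) →
            ∃[ e ] (y ℤ.+ + (e + e) ≡ n) →
            -- The right-hand sides are added in swapped order so that `1ℤ ℤ.+ + k` reduces to
            -- `+ suc k` in the two uses below.
            ∃[ e ] ((x ℤ.+ y) ℤ.+ + (e + e) ≡ n ℤ.+ m)
  add-odd x y (e , p) (e′ , q) = e + e′ , (begin
    (x ℤ.+ y) ℤ.+ + ((e + e′) + (e + e′))
      ≡⟨ rearrange x y (+ e) (+ e′) ⟩
    (y ℤ.+ + (e′ + e′)) ℤ.+ (x ℤ.+ + (e + e))
      ≡⟨ cong₂ ℤ._+_ q p ⟩
    _ ∎)
    where
    open ≡-Reasoning
    rearrange : ∀ x y e e′ →
      (x ℤ.+ y) ℤ.+ ((e ℤ.+ e′) ℤ.+ (e ℤ.+ e′)) ≡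
      (y ℤ.+ (e′ ℤ.+ e′)) ℤ.+ (x ℤ.+ (e ℤ.+ e))
    rearrange = solve-∀

climb-odd : ∀ f k → (∀ {j} → j < k → f j ≢ f (suc j)) →
            ∃[ e ] (climb f k ℤ.+ + (e + e) ≡ + k)
climb-odd f zero    proper = 0 , refl
climb-odd f (suc k) proper = add-odd (climb f k) (δ (f k) (f (suc k)))
  (climb-odd f k (proper ∘ m<n⇒m<1+n)) (δ-odd _ _ (proper ≤-refl))

winding-odd : ∀ m f → ProperCycle m f →
              ∃[ e ] (winding m f ℤ.+ + (e + e) ≡ + suc m)
winding-odd m f (proper , closed) =
  add-odd (climb f m) (δ (f m) (f 0)) (climb-odd f m proper) (δ-odd _ _ closed)

module _ {f g : ℕ → Fin 3} where

  private
    glue : ∀ p q d d′ e₀ e e′ → p ℤ.+ e ≡ e₀ ℤ.+ q → d ℤ.+ e′ ≡ e ℤ.+ d′ →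
           (p ℤ.+ d) ℤ.+ e′ ≡ e₀ ℤ.+ (q ℤ.+ d′)
    glue p q d d′ e₀ e e′ left right = begin
      (p ℤ.+ d) ℤ.+ e′  ≡⟨ ℤ.+-assoc p d e′ ⟩
      p ℤ.+ (d ℤ.+ e′)  ≡⟨ cong (λ x → p ℤ.+ x) right ⟩
      p ℤ.+ (e ℤ.+ d′)  ≡⟨ ℤ.+-assoc p e d′ ⟨
      (p ℤ.+ e) ℤ.+ d′  ≡⟨ cong (ℤ._+ d′) left ⟩
      (e₀ ℤ.+ q) ℤ.+ d′ ≡⟨ ℤ.+-assoc e₀ q d′ ⟩
      e₀ ℤ.+ (q ℤ.+ d′) ∎
      where open ≡-Reasoning

  -- Going along `f` and then down the last rung costs the same as going down the first rung and
  -- then along `g`: the squares in between are passed one at a time by `δ-square`.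
  climb-ladder : ∀ k →
    (∀ {j} → j < k → f j ≢ f (suc j)) → (∀ {j} → j < k → g j ≢ g (suc j)) →
    (∀ {j} → j ≤ k → f j ≢ g j) →
    climb f k ℤ.+ δ (f k) (g k) ≡ δ (f 0) (g 0) ℤ.+ climb g k
  climb-ladder zero    _  _  _    = ℤ.+-comm 0ℤ (δ (f 0) (g 0))
  climb-ladder (suc k) pf pg rung = glue
    (climb f k) (climb g k) (δ (f k) (f (suc k))) (δ (g k) (g (suc k)))
    (δ (f 0) (g 0)) (δ (f k) (g k)) (δ (f (suc k)) (g (suc k)))
    (climb-ladder k (pf ∘ m<n⇒m<1+n) (pg ∘ m<n⇒m<1+n) (rung ∘ m≤n⇒m≤1+n))
    (δ-square _ _ _ _ (pf ≤-refl) (rung ≤-refl) (rung (n≤1+n k)) (pg ≤-refl))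

  -- The closing edges form one more square, between the last rung and the first. After it the rung
  -- `δ (f 0) (g 0)` stands on both sides and cancels.
  winding-ladder : ∀ m → ProperCycle m f → ProperCycle m g →
                   (∀ {j} → j ≤ m → f j ≢ g j) → winding m f ≡ winding m g
  winding-ladder m (pf , cf) (pg , cg) rung =
    Group.∙-cancelˡ (δ (f 0) (g 0)) _ _ (trans
      (ℤ.+-comm (δ (f 0) (g 0)) _)
      (glue (climb f m) (climb g m) (δ (f m) (f 0)) (δ (g m) (g 0))
            (δ (f 0) (g 0)) (δ (f m) (g m)) (δ (f 0) (g 0))
            (climb-ladder m pf pg rung)
            (δ-square _ _ _ _ cf (rung z≤n) (rung ≤-refl) cg)))
    where import Algebra.Properties.AbelianGroup ℤ.+-0-abelianGroup as Group

private
  cancel-middle : ∀ a b c d → b ℤ.+ c ≡ 0ℤ →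
                  (a ℤ.+ b) ℤ.+ (d ℤ.+ c) ≡ a ℤ.+ d
  cancel-middle a b c d b+c≡0 = begin
    (a ℤ.+ b) ℤ.+ (d ℤ.+ c) ≡⟨ rearrange a b c d ⟩
    (a ℤ.+ d) ℤ.+ (b ℤ.+ c) ≡⟨ cong (λ x → (a ℤ.+ d) ℤ.+ x) b+c≡0 ⟩
    (a ℤ.+ d) ℤ.+ 0ℤ        ≡⟨ ℤ.+-identityʳ _ ⟩
    a ℤ.+ d                 ∎
    where
    open ≡-Reasoning
    rearrange : ∀ a b c d →
      (a ℤ.+ b) ℤ.+ (d ℤ.+ c) ≡ (a ℤ.+ d) ℤ.+ (b ℤ.+ c)
    rearrange = solve-∀

-- Walking back `k` steps from the end undoes the last `k` steps of the climb, each by `δ-antisym`.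
climb-reverse : ∀ f m k → k ≤ m →
                climb f m ℤ.+ climb (λ j → f (m ∸ j)) k ≡ climb f (m ∸ k)
climb-reverse f m zero    _   = ℤ.+-identityʳ _
climb-reverse f m (suc k) k<m = begin
  climb f m ℤ.+ (climb rev k ℤ.+ δ (f (m ∸ k)) (f n))
    ≡⟨ ℤ.+-assoc (climb f m) _ _ ⟨
  (climb f m ℤ.+ climb rev k) ℤ.+ δ (f (m ∸ k)) (f n)
    ≡⟨ cong (ℤ._+ δ (f (m ∸ k)) (f n)) (climb-reverse f m k (<⇒≤ k<m)) ⟩
  climb f (m ∸ k) ℤ.+ δ (f (m ∸ k)) (f n)
    -- Here `m ∸ k` becomes `suc n`, which exposes the last step of the climb.
    ≡⟨ cong (λ l → climb f l ℤ.+ δ (f l) (f n)) (+-∸-assoc 1 k<m) ⟩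
  (climb f n ℤ.+ δ (f n) (f (suc n))) ℤ.+ δ (f (suc n)) (f n)
    ≡⟨ ℤ.+-assoc (climb f n) _ _ ⟩
  climb f n ℤ.+ (δ (f n) (f (suc n)) ℤ.+ δ (f (suc n)) (f n))
    ≡⟨ cong (λ x → climb f n ℤ.+ x) (δ-antisym (f n) (f (suc n))) ⟩
  climb f n ℤ.+ 0ℤ
    ≡⟨ ℤ.+-identityʳ _ ⟩
  climb f n ∎
  where
  open ≡-Reasoning
  n = m ∸ suc k
  rev = λ j → f (m ∸ j)

winding-reverse : ∀ m f → winding m f ℤ.+ winding m (λ j → f (m ∸ j)) ≡ 0ℤ
winding-reverse m f = begin
  winding m f ℤ.+ (climb rev m ℤ.+ δ (f (m ∸ m)) (f m))
    ≡⟨ cancel-middle (climb f m) (δ (f m) (f 0)) _ (climb rev m)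
         (trans (cong (λ l → δ (f m) (f 0) ℤ.+ δ (f l) (f m)) (n∸n≡0 m))
                (δ-antisym (f m) (f 0))) ⟩
  climb f m ℤ.+ climb rev m
    ≡⟨ climb-reverse f m m ≤-refl ⟩
  climb f (m ∸ m)
    ≡⟨ cong (climb f) (n∸n≡0 m) ⟩
  0ℤ ∎
  where
  open ≡-Reasoning
  rev = λ j → f (m ∸ j)

-- Relabelling an adversary

-- `ρ` need not be an automorphism: edges that start outside `Inside 1` may be torn. Since `ρ` is an
-- involution, preserving adjacency in one direction also yields the converse where it is needed.
record LocalSymmetry (G : Graph) : Set₁ where
  open Graph G
  field
    ρ            : Node → Node
    ρ-involutive : ∀ v → ρ (ρ v) ≡ v
    -- Inside k u makes ρ a local isomorphism along walks of length k from u.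
    Inside       : ℕ → Pred Node 0ℓ
    inside-≤     : ∀ {k l v} → k ≤ l → Inside l v → Inside k v
    inside-ρ     : ∀ {k v} → Inside k v → Inside k (ρ v)
    step         : ∀ {k u v} → Inside (suc k) u → Adj u v →
                   Adj (ρ u) (ρ v) × Inside k v

module _ {G : Graph} (S : LocalSymmetry G) where
  open Graph G
  open LocalSymmetry S

  ρ↔ : Node ↔ Node
  ρ↔ = mk↔ₛ′ ρ ρ ρ-involutive ρ-involutive

  -- The graph stays fixed while identifiers and presentation order are carried along by `ρ`. This
  -- replaces running the algorithm on a second graph, and the same identifiers still arrive in the
  -- same order.
  relabel : ∀ {N} → Adversary N G → Adversary N G
  relabel adv = record
    { identifiers = identifiers ↣-∘ Inverse⇒Injection ρ↔
    ; ordering    = ρ↔ ↔-∘ ordering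
    }
    where open Adversary adv

  walk-ρ : ∀ {k l u v} → Inside (k + l) u → Walk k u v →
           Walk k (ρ u) (ρ v) × Inside l v
  walk-ρ in-u []      = [] , in-u
  walk-ρ in-u (e ∷ p) with step in-u e
  ... | e′ , in-v with walk-ρ in-v p
  ...   | p′ , in-w = e′ ∷ p′ , in-w

  -- Starting with margin `T + 1` leaves margin 1 at the end of the walk. `view-relabel` spends it
  -- on the edges between nodes of the region, including those on its boundary.
  near-ρ : ∀ {T u v} → Inside (T + 1) u → DistanceAtMost T u v →
           DistanceAtMost T (ρ u) (ρ v) × Inside 1 v
  near-ρ in-u (k , k≤T , p) with walk-ρ (inside-≤ (+-monoˡ-≤ 1 k≤T) in-u) p
  ... | p′ , in-v = (k , k≤T , p′) , in-v

  module _ {N} (adv : Adversary N G) (T : ℕ) (i : Fin size)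
           (early : ∀ {j} → j Fin.≤ i → Inside (T + 1) (Adversary.σ adv j))
           where

    private
      module A = Adversary adv
      module B = Adversary (relabel adv)

    region⇒ : ∀ {v} → A.Region T i v → B.Region T i (ρ v) × Inside 1 v
    region⇒ (j , j≤i , _ , refl , near) with near-ρ (early j≤i) near
    ... | near′ , in-v = (j , j≤i , _ , refl , near′) , in-v

    region⇐ : ∀ {v} → B.Region T i v → A.Region T i (ρ v) × Inside 1 v
    region⇐ (j , j≤i , _ , refl , near) with near-ρ (inside-ρ (early j≤i)) near
    ... | near′ , in-v =
      (j , j≤i , _ , refl
         , subst (λ u → DistanceAtMost T u _) (ρ-involutive _) near′) , in-v

    identifier-ρ : ∀ v → B.identifier (ρ v) ≡ A.identifier v
    identifier-ρ v = cong A.identifier (ρ-involutive v)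

    -- The map `ρ` matches the nodes of the two regions and respects their identifiers. A view
    -- stores only identifiers and bits, so equivalent membership and edge predicates give equal
    -- views.
    view-relabel : B.view T i ≡ A.view T i
    view-relabel = cong₃-view
      (cong (List.take (suc (toℕ i)))
        (List.tabulate-cong λ j → identifier-ρ (A.σ j)))
      (Vec.tabulate-cong λ x → does-⇔
        (mk⇔ (λ (v , id , reg) → ρ v , id , proj₁ (region⇐ reg))
             (λ (v , id , reg) →
               ρ v , trans (identifier-ρ v) id , proj₁ (region⇒ reg)))
        (B.seenId? T i x) (A.seenId? T i x))
      (Vec.tabulate-cong λ x → Vec.tabulate-cong λ y → does-⇔
        (mk⇔ (λ { (u , (idu , ru) , v , (idv , rv) , e) →
                  let ru′ , in-u = region⇐ ru in
                  ρ u , (idu , ru′) , ρ v , (idv , proj₁ (region⇐ rv)) ,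
                  proj₁ (step in-u e) })
             (λ { (u , (idu , ru) , v , (idv , rv) , e) →
                  let ru′ , in-u = region⇒ ru in
                  ρ u , (trans (identifier-ρ u) idu , ru′) ,
                  ρ v , (trans (identifier-ρ v) idv , proj₁ (region⇒ rv)) ,
                  proj₁ (step in-u e) }))
        (B.seenEdge? T i x y) (A.seenEdge? T i x y))
      where
      cong₃-view : ∀ {p p′ s s′ e e′} → p ≡ p′ → s ≡ s′ → e ≡ e′ →
        _≡_ {A = View N} (record { presented = p ; seen = s ; edges = e })
          (record { presented = p′ ; seen = s′ ; edges = e′ })
      cong₃-view refl refl refl = refl

  EarlyInside : ∀ {N} → Adversary N G → ℕ → Pred Node 0ℓ
  EarlyInside adv T v =
    ∀ {t} → t Fin.≤ Adversary.time adv v → Inside (T + 1) (Adversary.σ adv t)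

  -- In the relabelled run `v` carries the identifier of `ρ v` and is presented at its time, so the
  -- algorithm answers from the same view.
  colouring-relabel : ∀ {idBound k} (A : Algorithm idBound k)
    (adv : Adversary (idBound size) G) {v w} → ρ v ≡ w →
    EarlyInside adv (Algorithm.locality A size) w →
    colouring A G (relabel adv) v ≡ colouring A G adv w
  colouring-relabel A adv {w = w} refl early = cong (Algorithm.output A size)
    (view-relabel adv (Algorithm.locality A size) (Adversary.time adv w) early)

-- Grids

Position : ℕ → Set
Position s = Fin s × Fin s

-- A common interface for both families. The winding argument needs only the edges that they share
-- (`simple⊆`, `row⊆`), while confining walks needs only the upper bound `⊆torus`.
record WrappedGrid (s : ℕ) : Set₁ where
  field
    Adj        : Rel (Position s) 0ℓ
    adj?       : Decidable₂ Adj
    adj-sym    : Symmetric Adj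
    adj-irrefl : Irreflexive _≡_ Adj
    simple⊆    : ∀ {u v} → SimpleGridEdge s s u v → Adj u v
    row⊆       : ∀ {u v} → RowWrap s s u v → Adj u v
    ⊆torus     : ∀ {u v} → Adj u v → Graph.Adj (toroidalGrid s s) u v
    reflect    : ∀ {i j i′ j′} → Adj (i , j) (i′ , j′) →
                 Adj (i , opposite j) (i′ , opposite j′)

  graph : Graph
  graph = record
    { Node = Position s ; size = s * s ; enum = Fin.*↔×
    ; Adj = Adj ; adj? = adj? ; adj-sym = adj-sym ; adj-irrefl = adj-irrefl }

opposite-+ : ∀ {s} (j : Fin s) → toℕ (opposite j) + suc (toℕ j) ≡ s
opposite-+ j = trans (cong (_+ suc (toℕ j)) (Fin.opposite-prop j))
                     (m∸n+n≡m (Fin.toℕ<n j))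

∣opposite-opposite∣ : ∀ {s} (j j′ : Fin s) →
  ∣ toℕ (opposite j) - toℕ (opposite j′) ∣ ≡ ∣ toℕ j - toℕ j′ ∣
∣opposite-opposite∣ {s} j j′ = begin
  ∣ o - o′ ∣                             ≡⟨ ∣m+n-m+o∣≡∣n-o∣ (suc a + suc a′) o o′ ⟨
  ∣ suc a + suc a′ + o - suc a + suc a′ + o′ ∣
    ≡⟨ cong₂ ∣_-_∣ (rearrange (suc a) (suc a′) o) (rearrange′ (suc a) (suc a′) o′) ⟩
  ∣ (o + suc a) + suc a′ - (o′ + suc a′) + suc a ∣
    ≡⟨ cong₂ (λ x y → ∣ x + suc a′ - y + suc a ∣) (opposite-+ j) (opposite-+ j′) ⟩
  ∣ s + suc a′ - s + suc a ∣             ≡⟨ ∣m+n-m+o∣≡∣n-o∣ s (suc a′) (suc a) ⟩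
  ∣ a′ - a ∣                             ≡⟨ ∣-∣-comm a′ a ⟩
  ∣ a - a′ ∣                             ∎
  where
  open ≡-Reasoning
  a = toℕ j
  a′ = toℕ j′
  o = toℕ (opposite j)
  o′ = toℕ (opposite j′)
  rearrange : ∀ a a′ o → a + a′ + o ≡ (o + a) + a′
  rearrange = ℕ-Solver.solve-∀
  rearrange′ : ∀ a a′ o → a + a′ + o ≡ (o + a′) + a
  rearrange′ = ℕ-Solver.solve-∀

simpleEdge-opposite : ∀ {s} (i i′ j j′ : Fin s) →
  SimpleGridEdge s s (i , j) (i′ , j′) →
  SimpleGridEdge s s (i , opposite j) (i′ , opposite j′)
simpleEdge-opposite i i′ j j′ =
  trans (cong (λ x → ∣ toℕ i - toℕ i′ ∣ + x) (∣opposite-opposite∣ j j′))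

firstLast-opposite : ∀ {s} {x y : Fin s} →
  FirstLast x y → FirstLast (opposite y) (opposite x)
firstLast-opposite {s} {x} {y} (x≡0 , y≡s) =
    +-cancelʳ-≡ (suc (toℕ y)) _ 0 (trans (opposite-+ y) (sym y≡s))
  , trans (trans (+-comm 1 _) (cong (λ l → toℕ (opposite x) + suc l) (sym x≡0)))
          (opposite-+ x)

wrap-opposite : ∀ {s} {x y : Fin s} → Wrap x y → Wrap (opposite x) (opposite y)
wrap-opposite {x = x} {y} (ends , x≢y) =
    Sum.swap (Sum.map firstLast-opposite firstLast-opposite ends)
  , λ eq → x≢y (trans (sym (Fin.opposite-involutive x))
                      (trans (cong opposite eq) (Fin.opposite-involutive y)))

cylindrical : ∀ s → WrappedGrid s
cylindrical s = record
  { Graph (cylindricalGrid s s)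
  ; simple⊆ = inj₁
  ; row⊆    = inj₂
  ; ⊆torus  = inj₁
  ; reflect = λ {i j i′ j′} → Sum.map
      (simpleEdge-opposite i i′ j j′) (λ (p , w) → p , wrap-opposite w)
  }

toroidal : ∀ s → WrappedGrid s
toroidal s = record
  { Graph (toroidalGrid s s)
  ; simple⊆ = inj₁ ∘ inj₁
  ; row⊆    = inj₁ ∘ inj₂
  ; ⊆torus  = λ e → e
  ; reflect = λ {i j i′ j′} → Sum.map
      (Sum.map (simpleEdge-opposite i i′ j j′) (λ (p , w) → p , wrap-opposite w))
      (λ (p , w) → cong opposite p , w)
  }

-- Walks confined to a band of rows

Within : ℕ → ℕ → ℕ → ℕ → Set
Within lo hi k i = lo + k ≤ i × i + k < hi

within-≤ : ∀ lo {hi k l i} → k ≤ l → Within lo hi l i → Within lo hi k i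
within-≤ lo k≤l (low , high) =
  ≤-trans (+-monoʳ-≤ lo k≤l) low , ≤-<-trans (+-monoʳ-≤ _ k≤l) high

within-step : ∀ {lo hi k i i′} → ∣ i - i′ ∣ ≤ 1 →
              Within lo hi (suc k) i → Within lo hi k i′
within-step {lo} {hi} {k} {i} {i′} close (low , high) =
    s≤s⁻¹ (begin
      suc (lo + k)     ≡⟨ +-suc lo k ⟨
      lo + suc k       ≤⟨ low ⟩
      i                ≤⟨ m≤n+∣m-n∣ i i′ ⟩
      i′ + ∣ i - i′ ∣  ≤⟨ +-monoʳ-≤ i′ close ⟩
      i′ + 1           ≡⟨ +-comm i′ 1 ⟩
      suc i′           ∎)
  , (begin-strict
      i′ + k               ≤⟨ +-monoˡ-≤ k (m≤n+∣n-m∣ i′ i) ⟩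
      i + ∣ i - i′ ∣ + k   ≤⟨ +-monoˡ-≤ k (+-monoʳ-≤ i close) ⟩
      i + 1 + k            ≡⟨ +-assoc i 1 k ⟩
      i + suc k            <⟨ high ⟩
      hi                   ∎)
  where open ≤-Reasoning

-- A column wrap edge starts in row 0 or row `s - 1`, and a margin of one inside a band with
-- `hi ≤ s` rules out both. Every other edge changes the row by at most one.
within-torus : ∀ {s lo hi k} {i j i′ j′ : Fin s} → hi ≤ s →
               Graph.Adj (toroidalGrid s s) (i , j) (i′ , j′) →
               Within lo hi (suc k) (toℕ i) → Within lo hi k (toℕ i′)
within-torus hi≤s (inj₁ (inj₁ e)) within =
  within-step (≤-trans (m≤m+n _ _) (≤-reflexive e)) within
within-torus {i = i} hi≤s (inj₁ (inj₂ (refl , _))) within =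
  within-step (≤-trans (≤-reflexive (∣n-n∣≡0 (toℕ i))) z≤n) within
within-torus {lo = lo} hi≤s (inj₂ (_ , inj₁ (i≡0 , _) , _)) (low , _) =
  contradiction (≤-trans (≤-trans (s≤s z≤n) (m≤n+m _ lo)) low)
                (<-irrefl (sym i≡0))
within-torus {i = i} hi≤s (inj₂ (_ , inj₂ (_ , i≡s) , _)) (_ , high) =
  contradiction (≤-<-trans (+-monoʳ-≤ (toℕ i) (s≤s z≤n)) (<-≤-trans high hi≤s))
                (<-irrefl (trans (+-comm (toℕ i) 1) i≡s))

-- Reflections, transpositions and residues

opposite-if : ∀ {P : Set} {s} → Dec P → Fin s → Fin s
opposite-if (yes _) = opposite
opposite-if (no  _) j = j

opposite-if-involutive : ∀ {P : Set} {s} (P? : Dec P) (j : Fin s) →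
                         opposite-if P? (opposite-if P? j) ≡ j
opposite-if-involutive (yes _) = Fin.opposite-involutive
opposite-if-involutive (no  _) _ = refl

opposite-if-true : ∀ {P : Set} {s} (P? : Dec P) → P → (j : Fin s) →
                   opposite-if P? j ≡ opposite j
opposite-if-true (yes _) _ _ = refl
opposite-if-true (no ¬p) p _ = contradiction p ¬p

opposite-if-false : ∀ {P : Set} {s} (P? : Dec P) → ¬ P → (j : Fin s) →
                    opposite-if P? j ≡ j
opposite-if-false (yes p) ¬p _ = contradiction p ¬p
opposite-if-false (no _)  _  _ = refl

transpose-i : ∀ {n} (i j : Fin n) → transpose i j i ≡ j
transpose-i i j rewrite dec-true (i Fin.≟ i) refl = refl

transpose-≢ : ∀ {n} {i j k : Fin n} → k ≢ i → k ≢ j → transpose i j k ≡ k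
transpose-≢ {i = i} {j} {k} k≢i k≢j
  rewrite dec-false (k Fin.≟ i) k≢i | dec-false (k Fin.≟ j) k≢j = refl

toℕ-mod : ∀ {m j} → j ≤ m → toℕ (j mod suc m) ≡ j
toℕ-mod {m} {j} j≤m =
  trans (Fin.toℕ-fromℕ< (m%n<n j (suc m))) (m<n⇒m%n≡m (s≤s j≤m))

opposite-mod : ∀ {m j} → j ≤ m → opposite (j mod suc m) ≡ (m ∸ j) mod suc m
opposite-mod {m} {j} j≤m = Fin.toℕ-injective (begin
  toℕ (opposite (j mod suc m))   ≡⟨ Fin.opposite-prop (j mod suc m) ⟩
  m ∸ toℕ (j mod suc m)          ≡⟨ cong (m ∸_) (toℕ-mod j≤m) ⟩
  m ∸ j                          ≡⟨ toℕ-mod (m∸n≤m m j) ⟨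
  toℕ ((m ∸ j) mod suc m)        ∎)
  where open ≡-Reasoning

∣mod-mod∣ : ∀ {m j} → j < m → ∣ toℕ (j mod suc m) - toℕ (suc j mod suc m) ∣ ≡ 1
∣mod-mod∣ {m} {j} j<m = begin
  ∣ toℕ (j mod suc m) - toℕ (suc j mod suc m) ∣
    ≡⟨ cong₂ ∣_-_∣ (toℕ-mod (<⇒≤ j<m)) (toℕ-mod j<m) ⟩
  ∣ j - suc j ∣
    ≡⟨ cong₂ ∣_-_∣ (+-identityʳ j) (+-comm j 1) ⟨
  ∣ j + 0 - j + 1 ∣
    ≡⟨ ∣m+n-m+o∣≡∣n-o∣ j 0 1 ⟩
  1 ∎
  where open ≡-Reasoning

-- Winding numbers of rows

row : ∀ {m} → (Position (suc m) → Fin 3) → Fin (suc m) → ℕ → Fin 3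
-- Reduction modulo the row length only makes the row a total function on `ℕ`; windings read columns
-- up to `m`, where it is the identity.
row c i j = c (i , j mod _)

module _ {m} (G : WrappedGrid (suc m)) (0<m : 0 < m)
         {c : Position (suc m) → Fin 3} (proper : Proper (WrappedGrid.graph G) c)
         where
  open WrappedGrid G

  row-proper : ∀ i → ProperCycle m (row c i)
  row-proper i =
      (λ {j} j<m → proper {i , j mod _} {i , suc j mod _}
        (simple⊆ (cong₂ _+_ (∣n-n∣≡0 (toℕ i)) (∣mod-mod∣ j<m))))
    -- The wrap edge from the last column to the first. For `m = 0` it would be a loop, hence the
    -- hypothesis `0<m`.
    , proper (row⊆ (refl , inj₂ (toℕ-mod {m} z≤n , cong suc (toℕ-mod ≤-refl)) ,
        λ eq → <-irrefl (trans (sym (toℕ-mod {m} z≤n))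
                          (trans (cong toℕ (sym eq)) (toℕ-mod {m} ≤-refl))) 0<m))

  winding-row-0 : ∀ i → i ≤ m →
    winding m (row c (i mod suc m)) ≡ winding m (row c (0 mod suc m))
  winding-row-0 zero    _   = refl
  winding-row-0 (suc i) i<m = trans
    (sym (winding-ladder m (row-proper _) (row-proper _) λ {j} _ →
      proper {i mod _ , j mod _} {suc i mod _ , j mod _}
        (simple⊆ (cong₂ _+_ (∣mod-mod∣ i<m) (∣n-n∣≡0 (toℕ (j mod suc m)))))))
    (winding-row-0 i (<⇒≤ i<m))

  winding-row : ∀ i i′ → winding m (row c i) ≡ winding m (row c i′)
  winding-row i i′ = trans (to-0 i) (sym (to-0 i′))
    where
    to-0 : ∀ i → winding m (row c i) ≡ winding m (row c (0 mod suc m))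
    to-0 i = trans
      (cong (winding m ∘ row c)
        (Fin.toℕ-injective (sym (toℕ-mod (Fin.toℕ≤pred[n] i)))))
      (winding-row-0 (toℕ i) (Fin.toℕ≤pred[n] i))

-- Parity contradiction from a partial reflection

private
  self-negative : ∀ w s → w ℤ.+ w ≡ 0ℤ → ∃[ e ] (w ℤ.+ + (e + e) ≡ + s) → 2 ∣ s
  self-negative w s 2w≡0 (e , odd) = divides e (ℤ.+-injective (begin
    + s                 ≡⟨ odd ⟨
    w ℤ.+ + (e + e)     ≡⟨ cong (λ w → w ℤ.+ + (e + e)) w≡0 ⟩
    + (e + e)           ≡⟨ cong +_ (double e) ⟩
    + (e * 2)           ∎))
    where
    open ≡-Reasoning
    double : ∀ e → e + e ≡ e * 2
    double = ℕ-Solver.solve-∀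
    twice : ∀ w → w ℤ.+ w ≡ w ℤ.* + 2
    twice = solve-∀
    w≡0 : w ≡ 0ℤ
    w≡0 = ℤ.*-cancelʳ-≡ w 0ℤ (+ 2) (trans (sym (twice w)) 2w≡0)

-- The winding number `w` of row `a` is carried to row `b` twice, once through each colouring. The
-- colourings need not be related on any other row.
even-if-reflected : ∀ {m} (G : WrappedGrid (suc m)) → 0 < m →
  (let open WrappedGrid G) →
  {c₁ c₂ : Position (suc m) → Fin 3} → Proper graph c₁ → Proper graph c₂ →
  ∀ a b → (∀ j → c₂ (a , j) ≡ c₁ (a , j)) →
  (∀ j → c₂ (b , j) ≡ c₁ (b , opposite j)) → 2 ∣ suc m
even-if-reflected {m} G 0<m {c₁} {c₂} proper₁ proper₂ a b same reflected =
  self-negative w (suc m)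
    (begin
      w ℤ.+ w
        ≡⟨ cong₂ ℤ._+_ (winding-row G 0<m proper₁ a b) w≡ ⟩
      winding m (row c₁ b) ℤ.+ winding m (λ j → row c₁ b (m ∸ j))
        ≡⟨ winding-reverse m (row c₁ b) ⟩
      0ℤ ∎)
    (winding-odd m (row c₁ a) (row-proper G 0<m proper₁ a))
  where
  open ≡-Reasoning
  w = winding m (row c₁ a)
  w≡ : w ≡ winding m (λ j → row c₁ b (m ∸ j))
  w≡ = begin
    winding m (row c₁ a)
      ≡⟨ winding-cong m (λ {j} _ → same (j mod suc m)) ⟨
    winding m (row c₂ a)
      ≡⟨ winding-row G 0<m proper₂ a b ⟩
    winding m (row c₂ b)
      ≡⟨ winding-cong m (λ {j} j≤m → trans (reflected (j mod suc m))
           (cong (λ j → c₁ (b , j)) (opposite-mod j≤m))) ⟩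
    winding m (λ j → row c₁ b (m ∸ j)) ∎

even-if-symmetric : ∀ {m} (G : WrappedGrid (suc m)) → 0 < m →
  (let Γ = WrappedGrid.graph G; n = suc m * suc m) →
  (S : LocalSymmetry Γ) (let open LocalSymmetry S) →
  ∀ {idBound} (A : Algorithm idBound 3) → Solves A ｛ Γ ｝ →
  (adv : Adversary (idBound n) Γ) →
  (let T = Algorithm.locality A n) →
  ∀ a b → (∀ j → ρ (a , j) ≡ (a , j)) → (∀ j → ρ (b , j) ≡ (b , opposite j)) →
  (∀ j → EarlyInside S adv T (a , j)) → (∀ j → EarlyInside S adv T (b , j)) →
  2 ∣ suc m
even-if-symmetric G 0<m S A solves adv a b ρ-a ρ-b early-a early-b =
  even-if-reflected G 0<m (solves refl adv) (solves refl (relabel S adv)) a b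
    (λ j → colouring-relabel S A adv (ρ-a j) (early-a j))
    -- In the relabelled run `(b , j)` takes the colour of `(b , opposite j)`, so earliness is
    -- required of the latter.
    (λ j → colouring-relabel S A adv (ρ-b j) (early-b (opposite j)))

-- Rows a and b are presented first; the rows from h on are reflected.
module TwoRows
  {idBound} (idBound-large : ∀ n → n ≤ idBound n) (A : Algorithm idBound 3)
  {m} (large : 4 * Algorithm.locality A (suc m * suc m) + 6 ≤ m)
  (odd : 2 ∤ suc m) (G : WrappedGrid (suc m))
  (solves : Solves A ｛ WrappedGrid.graph G ｝)
  where
  open WrappedGrid G

  private
    s = suc m
    n = s * s
    T = Algorithm.locality A n
    -- Rows `a` and `b` need margin `T + 1` in the bands from 0 to `h` and from `h` to `s`. The
    -- upper margin of `a` fixes `h`, the lower margin of `b` fixes `b`, and the upper margin of `b`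
    -- is exactly `large`. Taking `a = T + 2` rather than `T + 1` keeps `a` different from row 1
    -- when `T = 0`, as `π` requires.
    h = 2 * T + 4
    a b : Fin s
    a = (T + 2) mod s
    b = (3 * T + 5) mod s

    h≤s : h ≤ s
    h≤s = ≤-trans (+-mono-≤ (*-monoˡ-≤ T {2} {4} (m≤m+n 2 2)) (m≤m+n 4 2))
                  (≤-trans large (n≤1+n m))

    toℕ-a : toℕ a ≡ T + 2
    toℕ-a = toℕ-mod (≤-trans (+-mono-≤ (m≤n*m T 4) (m≤m+n 2 4)) large)

    toℕ-b : toℕ b ≡ 3 * T + 5
    toℕ-b = toℕ-mod (≤-trans
      (+-mono-≤ (*-monoˡ-≤ T {3} {4} (m≤m+n 3 1)) (m≤m+n 5 1)) large)

    1<m : 1 < m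
    1<m = ≤-trans (≤-trans (m≤m+n 2 4) (m≤n+m 6 (4 * T))) large

    ρ : Position s → Position s
    ρ (i , j) = i , opposite-if (h ≤? toℕ i) j

    ρ-below : ∀ {i} → toℕ i < h → ∀ j → ρ (i , j) ≡ (i , j)
    ρ-below {i} i<h j = cong (i ,_) (opposite-if-false (h ≤? toℕ i) (<⇒≱ i<h) j)

    ρ-above : ∀ {i} → h ≤ toℕ i → ∀ j → ρ (i , j) ≡ (i , opposite j)
    ρ-above {i} h≤i j = cong (i ,_) (opposite-if-true (h ≤? toℕ i) h≤i j)

    a<h : toℕ a < h
    a<h = subst (_< h) (sym toℕ-a)
      (<-≤-trans (+-monoʳ-< T (m≤m+n 3 1)) (+-monoˡ-≤ 4 (m≤n*m T 2)))

    h≤b : h ≤ toℕ b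
    h≤b = subst (h ≤_) (sym toℕ-b)
      (+-mono-≤ (*-monoˡ-≤ T {2} {3} (m≤m+n 2 1)) (m≤m+n 4 1))

    Inside : ℕ → Pred (Position s) 0ℓ
    Inside k (i , _) = Within 0 h k (toℕ i) ⊎ Within h s k (toℕ i)

    -- Only edges between rows `h - 1` and `h` and column wrap edges can be torn. With positive
    -- margin both ends lie in the same band, so `ρ` fixes both or reflects both.
    step : ∀ {k u v} → Inside (suc k) u → Adj u v →
           Adj (ρ u) (ρ v) × Inside k v
    step {u = _ , j} {_ , j′} (inj₁ within@(_ , high)) e
      with within-torus h≤s (⊆torus e) within
    ... | within′@(_ , high′) =
        subst₂ Adj (sym (ρ-below (≤-<-trans (m≤m+n _ _) high) j))
                   (sym (ρ-below (≤-<-trans (m≤m+n _ _) high′) j′)) e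
      , inj₁ within′
    step {u = _ , j} {_ , j′} (inj₂ within@(low , _)) e
      with within-torus ≤-refl (⊆torus e) within
    ... | within′@(low′ , _) =
        subst₂ Adj (sym (ρ-above (≤-trans (m≤m+n _ _) low) j))
                   (sym (ρ-above (≤-trans (m≤m+n _ _) low′) j′)) (reflect e)
      , inj₂ within′

    S : LocalSymmetry graph
    S = record
      { ρ            = ρ
      ; ρ-involutive = λ (i , j) →
          cong (i ,_) (opposite-if-involutive (h ≤? toℕ i) j)
      ; Inside       = Inside
      ; inside-≤     = λ k≤l → Sum.map (within-≤ 0 k≤l) (within-≤ h k≤l)
      ; inside-ρ     = λ in-v → in-v
      ; step         = step
      }

    first second : Fin s
    first  = 0 mod s
    second = 1 mod s

    π : Perm.Permutation s s
    -- The transposition of `first` and `a` acts first. The second one leaves its result `a` in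
    -- place because `a` differs from both `second` and `b`.
    π = Perm.transpose first a Perm.∘ₚ Perm.transpose second b

    apart : ∀ {i j k l} → toℕ {s} i ≡ k → toℕ {s} j ≡ l → k ≢ l → i ≢ j
    apart i≡k j≡l k≢l i≡j = k≢l (trans (sym i≡k) (trans (cong toℕ i≡j) j≡l))

    π-first : π Perm.⟨$⟩ʳ first ≡ a
    π-first = trans
      (cong (transpose second b) (transpose-i first a))
      (transpose-≢
        (apart toℕ-a (toℕ-mod (<⇒≤ 1<m)) (>⇒≢ (m≤n+m 2 T)))
        (apart toℕ-a toℕ-b (<⇒≢ (+-mono-≤-< (m≤n*m T 3) (m≤m+n 3 2)))))

    π-second : π Perm.⟨$⟩ʳ second ≡ b
    π-second = trans
      (cong (transpose second b) (transpose-≢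
        (apart (toℕ-mod (<⇒≤ 1<m)) (toℕ-mod {m} z≤n) λ ())
        (apart (toℕ-mod (<⇒≤ 1<m)) toℕ-a (<⇒≢ (m≤n+m 2 T)))))
      (transpose-i second b)

    adv : Adversary (idBound n) graph
    adv = record
      { identifiers =
          mk↣ {to = λ i → Fin.inject≤ i (idBound-large n)}
              (Fin.inject≤-injective _ _ _ _)
          ↣-∘ Inverse⇒Injection (↔-sym Fin.*↔×)
      -- Row-major order with the rows permuted by `π`, so that rows `a` and `b` occupy the first
      -- `2 * s` times.
      ; ordering = (π ×-↔ ↔-id (Fin s)) ↔-∘ Fin.*↔×
      }
    open Adversary adv

    early-row : ∀ (q : Fin s) → toℕ q ≤ 1 →
                π Perm.⟨$⟩ʳ q ≡ a ⊎ π Perm.⟨$⟩ʳ q ≡ b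
    early-row q q≤1 with toℕ q in eq | q≤1
    ... | zero     | _ = inj₁ (trans
      (cong (π Perm.⟨$⟩ʳ_)
        (Fin.toℕ-injective (trans eq (sym (toℕ-mod {m} z≤n)))))
      π-first)
    ... | suc zero | _ = inj₂ (trans
      (cong (π Perm.⟨$⟩ʳ_)
        (Fin.toℕ-injective (trans eq (sym (toℕ-mod (<⇒≤ 1<m))))))
      π-second)
    ... | suc (suc _) | s≤s ()

    inside-row : ∀ {i j} → i ≡ a ⊎ i ≡ b → Inside (T + 1) (i , j)
    inside-row (inj₁ refl) = inj₁ (subst (Within 0 h (T + 1)) (sym toℕ-a)
      (+-monoʳ-≤ T (s≤s z≤n) , ≤-reflexive (sum T)))
      where
      sum : ∀ T → suc (T + 2 + (T + 1)) ≡ 2 * T + 4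
      sum = ℕ-Solver.solve-∀
    inside-row (inj₂ refl) = inj₂ (subst (Within h s (T + 1)) (sym toℕ-b)
      ( ≤-reflexive (sum T)
      , s≤s (≤-trans (≤-reflexive (sum′ T)) large)))
      where
      sum : ∀ T → 2 * T + 4 + (T + 1) ≡ 3 * T + 5
      sum = ℕ-Solver.solve-∀
      sum′ : ∀ T → 3 * T + 5 + (T + 1) ≡ 4 * T + 6
      sum′ = ℕ-Solver.solve-∀

    time-in-row : ∀ q {i} → π Perm.⟨$⟩ʳ q ≡ i → ∀ j →
                  time (i , j) ≡ Fin.combine q j
    time-in-row q refl j = cong (λ p → Fin.combine p j) (Perm.inverseˡ π {q})

    early : ∀ q → toℕ q ≤ 1 → ∀ {i} → π Perm.⟨$⟩ʳ q ≡ i →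
            ∀ j {t} → t Fin.≤ time (i , j) → Inside (T + 1) (σ t)
    early q q≤1 πq≡i j {t} t≤ =
      -- Row-major order is lexicographic: if the quotient of `t` exceeded `q`, then `t` would come
      -- after `time (i , j)`. So the quotient is at most 1 and `σ t` lies in row `a` or `b`.
      inside-row {j = j} (early-row (Fin.quotient {s} s t) (≤-trans (≮⇒≥ λ q<t →
        <⇒≱ (Fin.combine-monoˡ-< j (Fin.remainder {s} s t) q<t)
          (subst₂ Fin._≤_ (sym (Fin.combine-remQuot {s} s t))
                          (time-in-row q πq≡i j) t≤))
        q≤1))

  impossible : ⊥
  impossible = odd (even-if-symmetric G (<⇒≤ 1<m) S A solves adv a b
    (ρ-below a<h) (ρ-above h≤b)
    (early first (≤-trans (≤-reflexive (toℕ-mod {m} z≤n)) z≤n) π-first)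
    (early second (≤-reflexive (toℕ-mod (<⇒≤ 1<m))) π-second))

-- The constant and the threshold

1/8-scaled : ∀ s T → s ≤ 8 * T → (+ 1 / 8) ℚ.* (+ s / 1) ℚ.≤ + T / 1
-- In unnormalised rationals no gcd blocks reduction, and the claim becomes an inequality of
-- integers.
1/8-scaled s T s≤8T = ℚ.toℚᵘ-cancel-≤ (begin
  toℚᵘ ((+ 1 / 8) ℚ.* (+ s / 1))
    ≃⟨ ℚ.toℚᵘ-homo-* (+ 1 / 8) (+ s / 1) ⟩
  toℚᵘ (+ 1 / 8) ℚᵘ.* toℚᵘ (+ s / 1)
    ≃⟨ ℚᵘ.*-congˡ {toℚᵘ (+ 1 / 8)} (ℚ.toℚᵘ-fromℚᵘ (ℚᵘ.mkℚᵘ (+ s) 0)) ⟩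
  ℚᵘ.mkℚᵘ (+ 1) 7 ℚᵘ.* ℚᵘ.mkℚᵘ (+ s) 0
    ≤⟨ ℚᵘ.*≤* (subst₂ ℤ._≤_ (left (+ s)) right (ℤ.+≤+ s≤8T)) ⟩
  ℚᵘ.mkℚᵘ (+ T) 0
    ≃⟨ ℚ.toℚᵘ-fromℚᵘ (ℚᵘ.mkℚᵘ (+ T) 0) ⟨
  toℚᵘ (+ T / 1) ∎)
  where
  open ℚᵘ.≤-Reasoning
  left : ∀ s → s ≡ (+ 1 ℤ.* s) ℤ.* + 1
  left = solve-∀
  right : + (8 * T) ≡ + T ℤ.* + 8
  right = trans (ℤ.pos-* 8 T) (ℤ.*-comm (+ 8) (+ T))

lower-bound : ∀ {idBound} → (∀ n → n ≤ idBound n) →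
  ∀ s → 121 ≤ s * s → 2 ∤ s → (G : WrappedGrid s) →
  (A : Algorithm idBound 3) → Solves A ｛ WrappedGrid.graph G ｝ →
  (+ 1 / 8) ℚ.* (+ s / 1) ℚ.≤ + Algorithm.locality A (s * s) / 1
lower-bound idBound-large s@(suc m) 121≤s² odd G A solves
  with s ≤? 8 * Algorithm.locality A (s * s)
... | yes s≤8T = 1/8-scaled s (Algorithm.locality A (s * s)) s≤8T
... | no  s≰8T = ⊥-elim
  (TwoRows.impossible idBound-large A (large T (≰⇒> s≰8T)) odd G solves)
  where
  T = Algorithm.locality A (s * s)
  11≤s : 11 ≤ s
  11≤s = ≮⇒≥ λ s<11 → <⇒≱ (s≤s (*-mono-≤ (s≤s⁻¹ s<11) (s≤s⁻¹ s<11)))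
    (≤-trans (m≤m+n 101 20) 121≤s²)
  -- This is where 1/8 comes from: for `T` at least 2 the summand 6 is absorbed by `4 * T`. The
  -- cases 0 and 1 use `11≤s` instead, and `T = 1` needs exactly `10 ≤ m`.
  large : ∀ T → 8 * T < s → 4 * T + 6 ≤ m
  large zero             _    = ≤-trans (m≤m+n 6 4) (s≤s⁻¹ 11≤s)
  large (suc zero)       _    = s≤s⁻¹ 11≤s
  large T@(suc (suc T′)) 8T<s = begin
    4 * T + 6      ≤⟨ +-monoʳ-≤ (4 * T) (≤-trans (m≤m+n 6 2)
                        (*-monoʳ-≤ 4 (m≤m+n 2 T′))) ⟩
    4 * T + 4 * T  ≡⟨ *-distribʳ-+ T 4 4 ⟨
    8 * T          ≤⟨ s≤s⁻¹ 8T<s ⟩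
    m              ∎
    where open ≤-Reasoning

theorem2 : ∃[ c ] (0ℚ ℚ.< c ×
    ((idBound : ℕ → ℕ) → (∀ n → n ≤ idBound n) → PolynomiallyBounded idBound →
    ∃[ n₀ ] (∀ n s → n₀ ≤ n → n ≡ s * s → 2 ∤ s →
    ((A : Algorithm idBound 3) → Solves A ｛ toroidalGrid s s ｝ →
    c ℚ.* (+ s / 1) ℚ.≤ + Algorithm.locality A n / 1)
    ×
    ((A : Algorithm idBound 3) → Solves A ｛ cylindricalGrid s s ｝ →
    c ℚ.* (+ s / 1) ℚ.≤ + Algorithm.locality A n / 1))))
theorem2 = + 1 / 8 , ℚ.positive⁻¹ (+ 1 / 8) ,
  λ idBound idBound-large _ → 121 , λ { n s 121≤n refl odd →
    lower-bound idBound-large s 121≤n odd (toroidal s) ,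
    lower-bound idBound-large s 121≤n odd (cylindrical s) }
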